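{- Let $n\ge 1$ and $0\le k\le n-1$ be integers, and let $\sigma=s_1\cdots s_n\in S_n$ be a permutation. Then $$|\varphi_k^{ -1}(\sigma)| = \prod_{i=1}^n \ell_k(i;\sigma).$$
   Context: Write $[n]=\{1,\dots,n\}$. A street has parking spots $1,\dots,n$ in order, and cars $c_1,\dots,c_n$ arrive in this order. A parking preference is a tuple $\alpha=(a_1,\dots,a_n)\in[n]^n$, where $a_i$ is the preferred spot of $c_i$. $k$-Naples parking rule: car $c_i$ drives to spot $a_i$; if it is empty, $c_i$ parks there. If it is occupied, $c_i$ backs up one spot at a time, checking spots $a_i-1,a_i-2,\dots$ in turn, up to at most $k$ spots behind $a_i$ (and never past spot $1$), and parks in the first empty one it finds. If all of these spots are occupied, $c_i$ goes forward and parks in the first empty spot after $a_i$, if there is one; otherwise it fails to park. The preference $\alpha$ is a $k$-Naples parking function of length $n$ if all $n$ cars park under this rule; $PF_{n,k}$ is the set of all of these. $S_n$ is the symmetric group on $[n]$, with permutations in one-line notation. The map $\varphi_k:PF_{n,k}\to S_n$ sends $\alpha$ to $s_1s_2\cdots s_n$, where spot $i$ is occupied by car $c_{s_i}$ after all cars have parked under the $k$-Naples rule. $\varphi_k^{ -1}(\sigma)\subseteq PF_{n,k}$ denotes the fiber. For $\sigma=s_1\cdots s_n\in S_n$ and $1\le i\le n$ (subsequences here are blocks of consecutive entries): - $\mathtt{left}_k(i;\sigma)$ is the length of the longest subsequence $s_j\cdots s_{i-1}$ such that $s_t<s_i$ for all $j\le t<i$ (equal to $0$ if it is empty). - $\mathtt{right}_k(i;\sigma)$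 is the length of the longest subsequence $s_i\cdots s_r$ such that $r\le i+k$ (and $r\le n$) and $s_t\le s_i$ for all $i\le t\le r$. - $\ell_k(i;\sigma)=\mathtt{left}_k(i;\sigma)+\mathtt{right}_k(i;\sigma)$ if $\mathtt{left}_k(i;\sigma)=i-1$, and $\ell_k(i;\sigma)=\max(\mathtt{left}_k(i;\sigma)-k,0)+\mathtt{right}_k(i;\sigma)$ if $\mathtt{left}_k(i;\sigma)<i-1$. -}

module Defs where

open import Data.Bool.Base using (if_then_else_)
open import Data.Fin.Base using (Fin; zero; suc; toℕ; inject₁; punchOut; _<_; _≤_)
open import Data.Fin.Permutation using (Permutation′; permutation; _⟨$⟩ʳ_; _≈_; inverseˡ)
open import Data.Fin.Properties using (_≟_; _<?_; _≤?_; all?; any?; <⇒notInjective; punchOut-injective)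
open import Data.List.Base using (List; []; _∷_; _++_; map; foldl; allFin; take; filter; findᵇ; length)
open import Data.List.Extrema.Nat using (max)
open import Data.List.Membership.Propositional using (_∈_)
open import Data.List.Relation.Unary.Unique.Propositional using (Unique)
open import Data.Maybe.Base using (Maybe; just; nothing; is-nothing)
open import Data.Maybe.Properties using (just-injective)
open import Data.Nat.Base as ℕ using (ℕ; _+_; _∸_)
import Data.Nat.Properties as ℕ
open import Data.Product.Base using (Σ; ∃; _×_; _,_; proj₁; proj₂; Σ-syntax)
open import Data.Vec.Base using (Vec; lookup; replicate; _[_]≔_)
open import Function.Base using (_∘_)
open import Function.Bundles using (_⇔_)
open import Function.Definitions using (Injective)
open import Relation.Binary.PropositionalEquality using (_≡_; _≢_; refl; sym; trans; cong)
open import Relation.Nullary.Decidable using (yes; no; does; _×-dec_; _→-dec_)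
open import Relation.Nullary.Negation using (contradiction)
open import Relation.Unary using (Pred; Decidable)
open import Level using (Level; 0ℓ; _⊔_)

private
  variable
    n : ℕ

-- Spots and cars are both indexed from 0 by Fin n: the element i of Fin n is
-- spot toℕ i + 1 (respectively car c with subscript toℕ i + 1).

-- α lists, for each car, its preferred spot.
Preference : ℕ → Set
Preference n = Vec (Fin n) n

-- The entry at a spot is the car parked there, if any.
Street : ℕ → Set
Street n = Vec (Maybe (Fin n)) n

-- The spots before a, nearest first: a - 1, a - 2, …, first spot.
behind : Fin n → List (Fin n)
behind zero          = []
behind (suc a)       = inject₁ a ∷ map inject₁ (behind a)

-- The spots after a, nearest first: a + 1, a + 2, …, last spot.
ahead : Fin n → List (Fin n)
ahead {ℕ.suc n} zero = map suc (allFin n)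
ahead (suc a)        = map suc (ahead a)

-- The order in which a car preferring spot a checks spots under the k-Naples
-- rule; it parks in the first empty one.
route : ℕ → Fin n → List (Fin n)
route k a = a ∷ take k (behind a) ++ ahead a

-- A car that fails to park leaves the street unchanged.
parkCar : ℕ → Preference n → Street n → Fin n → Street n
parkCar k α s c with findᵇ (is-nothing ∘ lookup s) (route k (lookup α c))
... | just i  = s [ i ]≔ just c
... | nothing = s

-- The street after all cars have arrived in order.
outcome : ℕ → Preference n → Street n
outcome {n} k α = foldl (parkCar k α) (replicate n nothing) (allFin n)

-- Every car is parked somewhere at the end.
IsNaples : ℕ → Pred (Preference n) 0ℓ
IsNaples k α = ∀ c → ∃ λ i → lookup (outcome k α) i ≡ just c

PF : ℕ → ℕ → Set
PF n k = Σ (Preference n) (IsNaples k)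

private
  injective⇒surjective : {f : Fin n → Fin n} → Injective _≡_ _≡_ f →
                         ∀ y → ∃ λ x → f x ≡ y
  injective⇒surjective {ℕ.suc n} {f} inj y with any? (λ x → f x ≟ y)
  ... | yes hit  = hit
  ... | no  miss = contradiction
    (λ {x} {x′} eq → inj (punchOut-injective (avoids x) (avoids x′) eq))
    (<⇒notInjective {f = λ x → punchOut (avoids x)} (ℕ.n<1+n n))
    where
    avoids : ∀ x → y ≢ f x
    avoids x eq = miss (x , sym eq)

-- φ sends α to the permutation taking each spot to the car parked on it. Its
-- inverse is the map, read off from membership in PF n k, taking each car to
-- its spot; that map is injective, as a spot holds at most one car, hence
-- bijective.
φ : ∀ k → PF n k → Permutation′ n
φ {n} k (α , parked) = permutation car spot car-spot spot-car
  where
  spot : Fin n → Fin n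
  spot c = proj₁ (parked c)

  spot-injective : Injective _≡_ _≡_ spot
  spot-injective {c} {c′} eq = just-injective
    (trans (sym (proj₂ (parked c)))
      (trans (cong (lookup (outcome k α)) eq) (proj₂ (parked c′))))

  car : Fin n → Fin n
  car i = proj₁ (injective⇒surjective spot-injective i)

  spot-car : ∀ i → spot (car i) ≡ i
  spot-car i = proj₂ (injective⇒surjective spot-injective i)

  car-spot : ∀ c → car (spot c) ≡ c
  car-spot c = spot-injective (spot-car (spot c))

φ-occupant : ∀ k (π : PF n k) i →
             lookup (outcome k (proj₁ π)) i ≡ just (φ k π ⟨$⟩ʳ i)
φ-occupant k π@(α , parked) i =
  trans (cong (lookup (outcome k α)) (sym (inverseˡ (φ k π))))
        (proj₂ (parked (φ k π ⟨$⟩ʳ i)))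

-- The fiber, as a subset of all preferences. Equality of permutations (_≈_)
-- is pointwise.
φ⁻¹ : ℕ → Permutation′ n → Pred (Preference n) 0ℓ
φ⁻¹ k σ α = Σ[ parked ∈ IsNaples k α ] φ k (α , parked) ≈ σ

-- P has exactly m elements: they are enumerated without repetition by a list
-- of length m.
∣_∣≡_ : {a p : Level} {A : Set a} → Pred A p → ℕ → Set (a ⊔ p)
∣ P ∣≡ m = ∃ λ xs → Unique xs × (∀ x → x ∈ xs ⇔ P x) × length xs ≡ m

-- For a permutation σ, the entry s_i is σ ⟨$⟩ʳ i.

-- j is the start of a block s_j ⋯ s_{i-1} all of whose entries are smaller
-- than s_i; j = i gives the empty block.
LeftBlock : Permutation′ n → Fin n → Pred (Fin n) 0ℓ
LeftBlock σ i j =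
  j ≤ i × (∀ t → j ≤ t → t < i → σ ⟨$⟩ʳ t < σ ⟨$⟩ʳ i)

leftBlock? : (σ : Permutation′ n) (i : Fin n) → Decidable (LeftBlock σ i)
leftBlock? σ i j =
  j ≤? i ×-dec
  all? λ t → j ≤? t →-dec (t <? i →-dec σ ⟨$⟩ʳ t <? σ ⟨$⟩ʳ i)

-- r is the end of a block s_i ⋯ s_r with r ≤ i + k and all entries at most s_i.
RightBlock : ℕ → Permutation′ n → Fin n → Pred (Fin n) 0ℓ
RightBlock k σ i r =
  i ≤ r × toℕ r ℕ.≤ toℕ i + k × (∀ t → i ≤ t → t ≤ r → σ ⟨$⟩ʳ t ≤ σ ⟨$⟩ʳ i)

rightBlock? : ∀ k (σ : Permutation′ n) (i : Fin n) →
              Decidable (RightBlock k σ i)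
rightBlock? k σ i r =
  i ≤? r ×-dec toℕ r ℕ.≤? toℕ i + k ×-dec
  all? λ t → i ≤? t →-dec (t ≤? r →-dec σ ⟨$⟩ʳ t ≤? σ ⟨$⟩ʳ i)

-- Lengths of the longest such blocks. The length on the left does not
-- depend on k.
left : Permutation′ n → Fin n → ℕ
left {n} σ i =
  max 0 (map (λ j → toℕ i ∸ toℕ j) (filter (leftBlock? σ i) (allFin n)))

right : ℕ → Permutation′ n → Fin n → ℕ
right {n} k σ i =
  max 0 (map (λ r → ℕ.suc (toℕ r) ∸ toℕ i)
             (filter (rightBlock? k σ i) (allFin n)))

-- As indices start at 0, toℕ i is the number of entries before s_i. The
-- condition fails exactly when left σ i is smaller than that number, and
-- truncated subtraction gives the maximum with 0.
ℓ : ℕ → Permutation′ n → Fin n → ℕ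
ℓ k σ i =
  if does (left σ i ℕ.≟ toℕ i)
  then left σ i + right k σ i
  else (left σ i ∸ k) + right k σ i

{-# OPTIONS --safe #-}

-- The street that a car finds is determined by σ: a spot is occupied exactly
-- when its final occupant arrived earlier. So α lies in the fiber of σ iff each
-- car σ i, independently of the others, prefers a spot a whose route has i as
-- its first spot not held by an earlier car. By the block definitions, those a
-- form an interval of ℓ k σ i spots around i.
module Submission where

open import Data.Bool.Base using (Bool; T; if_then_else_)
open import Data.Fin.Base as Fin using (Fin; zero; suc; toℕ; inject₁; fromℕ<)
open import Data.Fin.Permutation using (Permutation′; _⟨$⟩ʳ_; _⟨$⟩ˡ_; inverseˡ; inverseʳ)
open import Data.Fin.Properties as Fin using
  (_≟_; toℕ-inject₁; toℕ-fromℕ<; toℕ-injective; toℕ<n)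
open import Data.List.Base using
  (List; []; _∷_; _++_; map; foldl; tabulate; allFin; take; filter; find; findᵇ;
   length; cartesianProductWith)
open import Data.List.Extrema.Nat using (max; xs≤max; argmax-sel)
open import Data.List.Membership.Propositional using (_∈_)
open import Data.List.Membership.Propositional.Properties using
  (∈-map⁺; ∈-map⁻; ∈-++⁺ˡ; ∈-++⁺ʳ; ∈-++⁻; ∈-tabulate⁺; ∈-tabulate⁻; ∈-allFin;
   ∈-filter⁺; ∈-filter⁻; ∈-cartesianProductWith⁺; ∈-cartesianProductWith⁻)
open import Data.List.Membership.Propositional.Properties.WithK using (unique∧set⇒bag)
open import Data.List.Properties using
  (length-++; length-map; length-tabulate; map-∘; map-tabulate; take-map)
open import Data.List.Relation.Binary.BagAndSetEquality using (∼bag⇒↭)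
open import Data.List.Relation.Binary.Permutation.Propositional using (_↭_)
import Data.List.Relation.Binary.Permutation.Propositional.Properties as ↭
open import Data.List.Relation.Unary.All as All using (All; []; _∷_)
import Data.List.Relation.Unary.All.Properties as All
open import Data.List.Relation.Unary.AllPairs as AllPairs using (AllPairs; []; _∷_)
import Data.List.Relation.Unary.AllPairs.Properties as AllPairs
open import Data.List.Relation.Unary.Any using (here; there)
open import Data.List.Relation.Unary.Unique.Propositional using (Unique)
import Data.List.Relation.Unary.Unique.Propositional.Properties as Unique
open import Data.Maybe.Base using (Maybe; just; nothing; is-nothing)
open import Data.Maybe.Properties using (just-injective)
open import Data.Nat.Base using (ℕ; zero; suc; _+_; _*_; _∸_; _≤_; _<_; z≤n; s≤s; s≤s⁻¹)
open import Data.Nat.ListAction using (product)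
open import Data.Nat.ListAction.Properties using (product-↭)
import Data.Nat.Properties as ℕ
open import Data.Product.Base using (∃; _×_; _,_; proj₁; proj₂)
open import Data.Sum.Base using (_⊎_; inj₁; inj₂)
open import Data.Unit.Base using (tt)
open import Data.Vec.Base as Vec using (Vec; lookup; replicate; _[_]≔_)
open import Data.Vec.Properties as Vec using
  (lookup∘update; lookup∘update′; lookup-replicate)
open import Function.Base using (_∘_; case_of_)
open import Function.Bundles using (_⇔_; mk⇔; Equivalence)
open import Function.Construct.Composition using (_⇔-∘_)
open import Function.Construct.Symmetry using (⇔-sym)
open import Level using (Level)
open import Relation.Binary.Core using (Rel)
open import Relation.Binary.Definitions using (Asymmetric; tri<; tri≈; tri>)
open import Relation.Binary.PropositionalEquality using
  (_≡_; refl; sym; trans; cong; cong₂; subst; subst₂; module ≡-Reasoning)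
open import Relation.Nullary.Decidable using (yes; no; T?; dec-true; dec-false)
open import Relation.Nullary.Negation using (¬_; contradiction)
open import Relation.Unary using (Pred; Decidable)
open import Defs

open Equivalence using (to; from)

private
  variable
    a b d p q r : Level
    A : Set a
    B : Set b
    C : Set d
    m n : ℕ

-- Cardinalities of products and intervals, and reindexing by a permutation.

∣∣≡-resp-⇔ : {P : Pred A p} {Q : Pred A q} → (∀ x → P x ⇔ Q x) →
             ∣ P ∣≡ m → ∣ Q ∣≡ m
∣∣≡-resp-⇔ P⇔Q (xs , uniq , enum , len) = xs , uniq , (λ x → P⇔Q x ⇔-∘ enum x) , len

length-cartesianProductWith : (f : A → B → C) (xs : List A) (ys : List B) →
  length (cartesianProductWith f xs ys) ≡ length xs * length ys
length-cartesianProductWith f []       ys = refl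
length-cartesianProductWith f (x ∷ xs) ys = trans
  (length-++ (map (f x) ys))
  (cong₂ _+_ (length-map (f x) ys) (length-cartesianProductWith f xs ys))

-- Conditions on separate coordinates cut out a product set, so the counts multiply. `P` varies with
-- the coordinate because each car has its own set of admissible spots.
∣Π∣ : {P : Fin m → Pred A p} (f : Fin m → ℕ) → (∀ i → ∣ P i ∣≡ f i) →
      ∣ (λ (v : Vec A m) → ∀ i → P i (lookup v i)) ∣≡ product (map f (allFin m))
∣Π∣ {m = zero} f _ =
  Vec.[] ∷ [] , [] ∷ [] , (λ { Vec.[] → mk⇔ (λ _ ()) (λ _ → here refl) }) , refl
∣Π∣ {m = suc m} {A = A} {P = P} f h
  with xs , xs! , xs⇔ , xs≡ ← h zero
     | vs , vs! , vs⇔ , vs≡ ← ∣Π∣ {P = P ∘ suc} (f ∘ suc) (h ∘ suc) =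
  cartesianProductWith Vec._∷_ xs vs ,
  Unique.cartesianProductWith⁺ Vec._∷_ Vec.∷-injective xs! vs! ,
  enum ,
  (begin
    length (cartesianProductWith Vec._∷_ xs vs)      ≡⟨ length-cartesianProductWith Vec._∷_ xs vs ⟩
    length xs * length vs                            ≡⟨ cong₂ _*_ xs≡ vs≡ ⟩
    f zero * product (map (f ∘ suc) (allFin m))      ≡⟨ cong (λ l → f zero * product l) (map-∘ (allFin m)) ⟩
    f zero * product (map f (map suc (allFin m)))    ≡⟨ cong (λ l → f zero * product (map f l))
                                                             (map-tabulate (λ i → i) suc) ⟩
    product (map f (allFin (suc m)))                 ∎)
  where
  open ≡-Reasoning

  enum : ∀ v → v ∈ cartesianProductWith Vec._∷_ xs vs ⇔ (∀ i → P i (lookup v i))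
  enum (x Vec.∷ v) = mk⇔
    (λ v∈ → split (∈-cartesianProductWith⁻ Vec._∷_ xs vs v∈))
    (λ h → ∈-cartesianProductWith⁺ Vec._∷_ (from (xs⇔ x) (h zero)) (from (vs⇔ v) (h ∘ suc)))
    where
    split : (∃ λ y → ∃ λ w → y ∈ xs × w ∈ vs × x Vec.∷ v ≡ y Vec.∷ w) →
            ∀ i → P i (lookup (x Vec.∷ v) i)
    split (_ , _ , y∈ , w∈ , refl) zero    = to (xs⇔ x) y∈
    split (_ , _ , y∈ , w∈ , refl) (suc i) = to (vs⇔ v) w∈ i

∣interval∣ : ∀ lo d → lo + d ≤ n →
             ∣ (λ (x : Fin n) → lo ≤ toℕ x × toℕ x < lo + d) ∣≡ d
∣interval∣ {n} lo d lo+d≤n =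
  tabulate elem , Unique.tabulate⁺ elem-injective , enum , length-tabulate elem
  where
  inRange : (i : Fin d) → lo + toℕ i < n
  inRange i = ℕ.<-≤-trans (ℕ.+-monoʳ-< lo (toℕ<n i)) lo+d≤n

  elem : Fin d → Fin n
  elem i = fromℕ< (inRange i)

  toℕ-elem : ∀ i → toℕ (elem i) ≡ lo + toℕ i
  toℕ-elem i = toℕ-fromℕ< (inRange i)

  elem-injective : ∀ {i j} → elem i ≡ elem j → i ≡ j
  elem-injective {i} {j} eq = toℕ-injective (ℕ.+-cancelˡ-≡ lo _ _
    (trans (sym (toℕ-elem i)) (trans (cong toℕ eq) (toℕ-elem j))))

  enum : ∀ x → x ∈ tabulate elem ⇔ (lo ≤ toℕ x × toℕ x < lo + d)
  enum x = mk⇔ (bounds ∘ ∈-tabulate⁻) hit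
    where
    bounds : (∃ λ i → x ≡ elem i) → lo ≤ toℕ x × toℕ x < lo + d
    bounds (i , refl) rewrite toℕ-elem i = ℕ.m≤m+n lo _ , ℕ.+-monoʳ-< lo (toℕ<n i)

    hit : lo ≤ toℕ x × toℕ x < lo + d → x ∈ tabulate elem
    hit (lo≤x , x<hi) = subst (_∈ tabulate elem) elem≡x (∈-tabulate⁺ i)
      where
      lo+[x∸lo]≡x : lo + (toℕ x ∸ lo) ≡ toℕ x
      lo+[x∸lo]≡x = ℕ.m+[n∸m]≡n lo≤x

      x∸lo<d : toℕ x ∸ lo < d
      x∸lo<d = ℕ.+-cancelˡ-< lo _ _ (subst (_< lo + d) (sym lo+[x∸lo]≡x) x<hi)

      i : Fin d
      i = fromℕ< x∸lo<d

      elem≡x : elem i ≡ x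
      elem≡x = toℕ-injective
        (trans (toℕ-elem i) (trans (cong (lo +_) (toℕ-fromℕ< x∸lo<d)) lo+[x∸lo]≡x))

-- Both lists are duplicate-free with the same members, so they agree as bags. This later turns a
-- product over cars into one over spots.
map-⟨$⟩ˡ-↭ : (σ : Permutation′ n) → map (σ ⟨$⟩ˡ_) (allFin n) ↭ allFin n
map-⟨$⟩ˡ-↭ {n} σ = ∼bag⇒↭ (unique∧set⇒bag
  (Unique.map⁺ ⟨$⟩ˡ-injective (Unique.allFin⁺ n)) (Unique.allFin⁺ n)
  (λ {x} → mk⇔ (λ _ → ∈-allFin x)
     (λ _ → subst (_∈ map (σ ⟨$⟩ˡ_) (allFin n)) (inverseˡ σ)
                  (∈-map⁺ (σ ⟨$⟩ˡ_) (∈-allFin (σ ⟨$⟩ʳ x))))))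
  where
  ⟨$⟩ˡ-injective : ∀ {i j} → σ ⟨$⟩ˡ i ≡ σ ⟨$⟩ˡ j → i ≡ j
  ⟨$⟩ˡ-injective eq = trans (sym (inverseʳ σ)) (trans (cong (σ ⟨$⟩ʳ_) eq) (inverseʳ σ))

⟨$⟩ʳ-injective : (σ : Permutation′ n) {i j : Fin n} → σ ⟨$⟩ʳ i ≡ σ ⟨$⟩ʳ j → i ≡ j
⟨$⟩ʳ-injective σ eq = trans (sym (inverseˡ σ)) (trans (cong (σ ⟨$⟩ˡ_) eq) (inverseˡ σ))

-- First hits of a search, and the checking order along a route.

module _ {P : Pred A p} (P? : Decidable P) where

  find-just⇒ : ∀ xs {x} → find P? xs ≡ just x → P x
  find-just⇒ (y ∷ xs) eq with P? y
  find-just⇒ (y ∷ xs) refl | yes py = py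
  find-just⇒ (y ∷ xs) eq   | no  _  = find-just⇒ xs eq

  -- Asymmetry keeps anything later in the list from being `R`-below `x`, so "earlier in the list"
  -- can be replaced by `R`. The first hit is thereby described without positions in the list.
  find-sorted : {R : Rel A r} → Asymmetric R → ∀ {xs} → AllPairs R xs → ∀ x →
    find P? xs ≡ just x ⇔ (x ∈ xs × P x × (∀ y → y ∈ xs → R y x → ¬ P y))
  find-sorted asym [] x = mk⇔ (λ ()) (λ { (() , _) })
  find-sorted asym {z ∷ xs} (Rz ∷ Rxs) x with P? z
  ... | yes pz = mk⇔
    (λ { refl → here refl , pz , λ
       { y (here refl) Ryx → contradiction Ryx (asym Ryx)
       ; y (there y∈)  Ryx → contradiction Ryx (asym (All.lookup Rz y∈)) } })
    (λ { (here refl , _)         → refl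
       ; (there x∈ , _ , first) → contradiction pz (first z (here refl) (All.lookup Rz x∈)) })
  ... | no ¬pz = mk⇔
    (λ eq → let x∈ , px , first = to (find-sorted asym Rxs x) eq in
       there x∈ , px , λ { y (here refl) _ → ¬pz ; y (there y∈) Ryx → first y y∈ Ryx })
    (λ { (here refl , px , _)    → contradiction px ¬pz
       ; (there x∈ , px , first) →
           from (find-sorted asym Rxs x) (x∈ , px , λ y y∈ → first y (there y∈)) })

∈-take-behind : ∀ k (a t : Fin n) →
  t ∈ take k (behind a) ⇔ (toℕ t < toℕ a × toℕ a ≤ toℕ t + k)
∈-take-behind zero a t = mk⇔ (λ ())
  λ (t<a , a≤t+0) → contradiction
    (ℕ.<-≤-trans t<a (subst (toℕ a ≤_) (ℕ.+-identityʳ (toℕ t)) a≤t+0)) (ℕ.<-irrefl refl)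
∈-take-behind (suc k) zero t = mk⇔ (λ ()) (λ { (() , _) })
-- Commuting `take` with `map` exposes the prefix of `behind a` to which the induction hypothesis
-- applies.
∈-take-behind (suc k) (suc a) t rewrite take-map {f = inject₁} k (behind a) =
  mk⇔ fwd bwd
  where
  fwd : t ∈ inject₁ a ∷ map inject₁ (take k (behind a)) →
        toℕ t < suc (toℕ a) × suc (toℕ a) ≤ toℕ t + suc k
  fwd (here refl) rewrite toℕ-inject₁ a =
    ℕ.≤-refl , subst (suc (toℕ a) ≤_) (sym (ℕ.+-suc (toℕ a) k)) (s≤s (ℕ.m≤m+n _ k))
  fwd (there t∈) with u , u∈ , refl ← ∈-map⁻ inject₁ t∈ rewrite toℕ-inject₁ u =
    let u<a , a≤u+k = to (∈-take-behind k a u) u∈ in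
    ℕ.m<n⇒m<1+n u<a , subst (suc (toℕ a) ≤_) (sym (ℕ.+-suc (toℕ u) k)) (s≤s a≤u+k)

  bwd : toℕ t < suc (toℕ a) × suc (toℕ a) ≤ toℕ t + suc k →
        t ∈ inject₁ a ∷ map inject₁ (take k (behind a))
  bwd (t<1+a , 1+a≤) with ℕ.m<1+n⇒m<n∨m≡n t<1+a
  ... | inj₂ t≡a = here (toℕ-injective (trans t≡a (sym (toℕ-inject₁ a))))
  ... | inj₁ t<a = there (subst (_∈ _) inject₁u≡t (∈-map⁺ inject₁
      (from (∈-take-behind k a u)
        ( subst (_< toℕ a) (sym u≡t) t<a
        , subst (λ x → toℕ a ≤ x + k) (sym u≡t)
            (s≤s⁻¹ (subst (suc (toℕ a) ≤_) (ℕ.+-suc (toℕ t) k) 1+a≤))))))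
    where
    t<n : toℕ t < _
    t<n = ℕ.<-trans t<a (toℕ<n a)

    u : Fin _
    u = fromℕ< t<n

    u≡t : toℕ u ≡ toℕ t
    u≡t = toℕ-fromℕ< t<n

    inject₁u≡t : inject₁ u ≡ t
    inject₁u≡t = toℕ-injective (trans (toℕ-inject₁ u) u≡t)

∈-ahead : (a t : Fin n) → t ∈ ahead a ⇔ toℕ a < toℕ t
∈-ahead {suc n} zero zero = mk⇔
  (λ t∈ → case ∈-map⁻ suc t∈ of λ { (_ , _ , ()) }) (λ ())
∈-ahead {suc n} zero (suc t) = mk⇔ (λ _ → s≤s z≤n) (λ _ → ∈-map⁺ suc (∈-allFin t))
∈-ahead (suc a) t = mk⇔ (fwd ∘ ∈-map⁻ suc) (bwd t)
  where
  fwd : (∃ λ u → u ∈ ahead a × t ≡ suc u) → suc (toℕ a) < toℕ t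
  fwd (u , u∈ , refl) = s≤s (to (∈-ahead a u) u∈)

  bwd : ∀ t → suc (toℕ a) < toℕ t → t ∈ map suc (ahead a)
  bwd (suc t) (s≤s a<t) = ∈-map⁺ suc (from (∈-ahead a t) a<t)

-- The order in which a car preferring a would check spots t and u if k did not
-- limit how far it backs up.
CheckedBefore : Fin n → Rel (Fin n) _
CheckedBefore a t u = (u Fin.< t × t Fin.≤ a) ⊎ (a Fin.< u × t Fin.< u)

checkedBefore-asym : (a : Fin n) → Asymmetric (CheckedBefore a)
checkedBefore-asym a (inj₁ (u<t , t≤a)) (inj₁ (t<u , _)) = ℕ.<-asym u<t t<u
checkedBefore-asym a (inj₁ (u<t , t≤a)) (inj₂ (a<t , _)) = ℕ.<⇒≱ a<t t≤a
checkedBefore-asym a (inj₂ (a<u , t<u)) (inj₁ (_ , u≤a)) = ℕ.<⇒≱ a<u u≤a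
checkedBefore-asym a (inj₂ (a<u , t<u)) (inj₂ (_ , u<t)) = ℕ.<-asym t<u u<t

behind-< : (a : Fin n) → All (Fin._< a) (behind a)
behind-< zero    = []
behind-< (suc a) = s≤s (ℕ.≤-reflexive (toℕ-inject₁ a)) ∷
  All.map⁺ (All.map (λ {t} t<a → subst (_< suc (toℕ a)) (sym (toℕ-inject₁ t)) (ℕ.m<n⇒m<1+n t<a))
                    (behind-< a))

behind-sorted : (a : Fin n) → AllPairs (λ t u → u Fin.< t) (behind a)
behind-sorted zero    = []
behind-sorted (suc a) =
  All.map⁺ (All.map (λ {t} → subst₂ _<_ (sym (toℕ-inject₁ t)) (sym (toℕ-inject₁ a)))
                    (behind-< a)) ∷
  AllPairs.map⁺ (AllPairs.map
    (λ {t} {u} → subst₂ _<_ (sym (toℕ-inject₁ u)) (sym (toℕ-inject₁ t))) (behind-sorted a))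

ahead-sorted : (a : Fin n) → AllPairs Fin._<_ (ahead a)
ahead-sorted {suc n} zero = AllPairs.map⁺ (AllPairs.tabulate⁺-< s≤s)
ahead-sorted (suc a)      = AllPairs.map⁺ (AllPairs.map s≤s (ahead-sorted a))

-- Used to pass from the plain orders on the two sides of `a` to `CheckedBefore a`: the `All`
-- hypothesis supplies the side on which the spots lie.
AllPairs-with-All : {P : Pred A p} {R S : Rel A r} →
  (∀ {x y} → P x → P y → R x y → S x y) →
  ∀ {xs} → All P xs → AllPairs R xs → AllPairs S xs
AllPairs-with-All f []         []         = []
AllPairs-with-All f (px ∷ pxs) (Rx ∷ Rxs) =
  All.zipWith (λ (py , Rxy) → f px py Rxy) (pxs , Rx) ∷ AllPairs-with-All f pxs Rxs

module _ (k : ℕ) (a : Fin n) where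

  private
    back-< : All (Fin._< a) (take k (behind a))
    back-< = All.take⁺ k (behind-< a)

    ahead-> : All (a Fin.<_) (ahead a)
    ahead-> = All.tabulate (to (∈-ahead a _))

  -- The backward segment decreases below `a`, the forward segment increases above it, and each
  -- forward spot comes after everything at or below `a`.
  route-sorted : AllPairs (CheckedBefore a) (route k a)
  route-sorted =
    All.++⁺ (All.map (λ t<a → inj₁ (t<a , ℕ.≤-refl)) back-<)
            (All.map (λ a<t → inj₂ (a<t , a<t)) ahead->) ∷
    AllPairs.++⁺
      (AllPairs-with-All (λ t<a _ u<t → inj₁ (u<t , ℕ.<⇒≤ t<a)) back-<
         (AllPairs.take⁺ k (behind-sorted a)))
      (AllPairs-with-All (λ _ a<u t<u → inj₂ (a<u , t<u)) ahead-> (ahead-sorted a))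
      (All.map (λ t<a → All.map (λ a<u → inj₂ (a<u , ℕ.<-trans t<a a<u)) ahead->) back-<)

  -- The limit on backing up is the only restriction: spots at or after `a` satisfy the inequality
  -- automatically, and spots before `a` satisfy it exactly when they are at most `k` behind.
  ∈-route : ∀ t → t ∈ route k a ⇔ toℕ a ≤ toℕ t + k
  ∈-route t = mk⇔ fwd bwd
    where
    fwd : t ∈ route k a → toℕ a ≤ toℕ t + k
    fwd (here refl) = ℕ.m≤m+n _ k
    fwd (there t∈) with ∈-++⁻ (take k (behind a)) t∈
    ... | inj₁ t∈ = proj₂ (to (∈-take-behind k a t) t∈)
    ... | inj₂ t∈ = ℕ.≤-trans (ℕ.<⇒≤ (to (∈-ahead a t) t∈)) (ℕ.m≤m+n _ k)

    bwd : toℕ a ≤ toℕ t + k → t ∈ route k a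
    bwd a≤t+k with ℕ.<-cmp (toℕ t) (toℕ a)
    ... | tri< t<a _ _ = there (∈-++⁺ˡ (from (∈-take-behind k a t) (t<a , a≤t+k)))
    ... | tri≈ _ t≡a _ = here (toℕ-injective t≡a)
    ... | tri> _ _ a<t = there (∈-++⁺ʳ (take k (behind a)) (from (∈-ahead a t) a<t))

-- The parking process, compared step by step with the street of `σ`.

OnlyEarlier : ℕ → Street n → Set
OnlyEarlier m s = ∀ j c → lookup s j ≡ just c → toℕ c < m

is-nothing⇒≡ : {x : Maybe A} → T (is-nothing x) → x ≡ nothing
is-nothing⇒≡ {x = nothing} _ = refl

≡⇒is-nothing : {x : Maybe A} → x ≡ nothing → T (is-nothing x)
≡⇒is-nothing refl = tt

module _ (k : ℕ) (σ : Permutation′ n) where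

  -- The final street of `σ` with the cars from index `m` on removed: empty for `m = 0`, complete
  -- for `m = n`.
  Filled : ℕ → Street n → Set
  Filled m s = ∀ j → (toℕ (σ ⟨$⟩ʳ j) < m → lookup s j ≡ just (σ ⟨$⟩ʳ j)) ×
                     (m ≤ toℕ (σ ⟨$⟩ʳ j) → lookup s j ≡ nothing)

  filled-free⇒ : ∀ {m s} j → Filled m s → lookup s j ≡ nothing → m ≤ toℕ (σ ⟨$⟩ʳ j)
  filled-free⇒ {m} {s} j filled eq with toℕ (σ ⟨$⟩ʳ j) ℕ.<? m
  ... | no  σj≮m = ℕ.≮⇒≥ σj≮m
  ... | yes σj<m with () ← trans (sym eq) (proj₁ (filled j) σj<m)

  filled⇒onlyEarlier : ∀ {m s} → Filled m s → OnlyEarlier m s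
  filled⇒onlyEarlier {m} {s} filled j c eq with toℕ (σ ⟨$⟩ʳ j) ℕ.<? m
  ... | yes σj<m = subst (λ x → toℕ x < m)
                     (just-injective (trans (sym (proj₁ (filled j) σj<m)) eq)) σj<m
  ... | no  σj≮m with () ← trans (sym eq) (proj₂ (filled j) (ℕ.≮⇒≥ σj≮m))

  -- A car preferring a parks at i when the occupied spots are those of the cars
  -- arriving before σ i.
  ParksAt : Fin n → Fin n → Set
  ParksAt i a = toℕ a ≤ toℕ i + k ×
    (∀ t → toℕ a ≤ toℕ t + k → CheckedBefore a t i → σ ⟨$⟩ʳ t Fin.< σ ⟨$⟩ʳ i)

  -- On such a street a spot `t` is free exactly when `σ i ≤ σ t`. Hence "no spot checked before `i`
  -- is free" becomes the strict inequality in `ParksAt`.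
  findᵇ-route : ∀ s i a → Filled (toℕ (σ ⟨$⟩ʳ i)) s →
    findᵇ (is-nothing ∘ lookup s) (route k a) ≡ just i ⇔ ParksAt i a
  findᵇ-route s i a filled = mk⇔
    (λ eq → let i∈ , _ , first = to sorted eq in
       to (∈-route k a i) i∈ ,
       λ t a≤t+k t≺i → ℕ.≰⇒> λ σi≤σt →
         first t (from (∈-route k a t) a≤t+k) t≺i (≡⇒is-nothing (proj₂ (filled t) σi≤σt)))
    (λ (a≤i+k , before) → from sorted
       ( from (∈-route k a i) a≤i+k
       , ≡⇒is-nothing (proj₂ (filled i) ℕ.≤-refl)
       , λ t t∈ t≺i free → ℕ.<⇒≱ (before t (to (∈-route k a t) t∈) t≺i)
           (filled-free⇒ {s = s} t filled (is-nothing⇒≡ free))))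
    where
    sorted = find-sorted (T? ∘ is-nothing ∘ lookup s) (checkedBefore-asym a) (route-sorted k a) i

  module _ (α : Preference n) where

    -- This invariant holds for every preference. The equivalences below are also read from the
    -- later street back to the earlier one, where `Filled` is not yet known for the earlier street
    -- and this weaker fact has to serve.
    parkCar-onlyEarlier : ∀ {s} c → OnlyEarlier (toℕ c) s →
                          OnlyEarlier (suc (toℕ c)) (parkCar k α s c)
    parkCar-onlyEarlier {s} c early j d eq
      with findᵇ (is-nothing ∘ lookup s) (route k (lookup α c))
    ... | nothing = ℕ.m<n⇒m<1+n (early j d eq)
    ... | just i with j ≟ i
    ...   | yes refl = s≤s (ℕ.≤-reflexive (cong toℕ (just-injective
                         (trans (sym eq) (lookup∘update i s (just c))))))
    ...   | no  j≢i  = ℕ.m<n⇒m<1+n (early j d (trans (sym (lookup∘update′ j≢i s (just c))) eq))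

    -- The direction back in time is the delicate one: `c` stands at `i` afterwards but, by `early`,
    -- nowhere in `s`, so this very step parked it at `i`. Then `i` was free in `s` and all other
    -- spots are unchanged.
    parkCar-filled-at : ∀ {s} i → let c = σ ⟨$⟩ʳ i in OnlyEarlier (toℕ c) s →
      Filled (suc (toℕ c)) (parkCar k α s c) ⇔ (Filled (toℕ c) s × ParksAt i (lookup α c))
    parkCar-filled-at {s} i early = mk⇔ fwd bwd
      where
      c : Fin n
      c = σ ⟨$⟩ʳ i

      search : Maybe (Fin n)
      search = findᵇ (is-nothing ∘ lookup s) (route k (lookup α c))

      fwd : Filled (suc (toℕ c)) (parkCar k α s c) →
            Filled (toℕ c) s × ParksAt i (lookup α c)
      fwd filled with search in found
      -- A failed search leaves the street as it was, so `c` would already stand at `i` in `s`.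
      ... | nothing = contradiction (early i c (proj₁ (filled i) (ℕ.n<1+n _))) (ℕ.<-irrefl refl)
      ... | just i′ = before , to (findᵇ-route s i (lookup α c) before) (trans found (cong just i′≡i))
        where
        i′≡i : i′ ≡ i
        i′≡i with i ≟ i′
        ... | yes eq   = sym eq
        ... | no  i≢i′ = contradiction
          (early i c (trans (sym (lookup∘update′ i≢i′ s (just c))) (proj₁ (filled i) (ℕ.n<1+n _))))
          (ℕ.<-irrefl refl)

        i-free : lookup s i ≡ nothing
        i-free = is-nothing⇒≡ (find-just⇒ (T? ∘ is-nothing ∘ lookup s) (route k (lookup α c))
                   (trans found (cong just i′≡i)))

        before : Filled (toℕ c) s
        before j with j ≟ i
        ... | yes refl = (λ c<c → contradiction c<c (ℕ.<-irrefl refl)) , (λ _ → i-free)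
        ... | no  j≢i  =
          (λ σj<c → trans (sym unchanged) (proj₁ (filled j) (ℕ.m<n⇒m<1+n σj<c))) ,
          (λ c≤σj → trans (sym unchanged) (proj₂ (filled j)
             (ℕ.≤∧≢⇒< c≤σj (λ eq → j≢i (⟨$⟩ʳ-injective σ (sym (toℕ-injective eq)))))))
          where
          unchanged : lookup (s [ i′ ]≔ just c) j ≡ lookup s j
          unchanged = lookup∘update′ (λ j≡i′ → j≢i (trans j≡i′ i′≡i)) s (just c)

      bwd : Filled (toℕ c) s × ParksAt i (lookup α c) →
            Filled (suc (toℕ c)) (parkCar k α s c)
      bwd (filled , parks) rewrite from (findᵇ-route s i (lookup α c) filled) parks = after
        where
        after : Filled (suc (toℕ c)) (s [ i ]≔ just c)
        after j with j ≟ i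
        ... | yes refl = (λ _ → lookup∘update i s (just c)) ,
                         (λ c<c → contradiction c<c (ℕ.<-irrefl refl))
        ... | no  j≢i  =
          (λ σj<1+c → trans unchanged (proj₁ (filled j)
             (ℕ.≤∧≢⇒< (s≤s⁻¹ σj<1+c) (λ eq → j≢i (⟨$⟩ʳ-injective σ (toℕ-injective eq)))))) ,
          (λ c<σj → trans unchanged (proj₂ (filled j) (ℕ.<⇒≤ c<σj)))
          where
          unchanged : lookup (s [ i ]≔ just c) j ≡ lookup s j
          unchanged = lookup∘update′ j≢i s (just c)

    Parks : Fin n → Set
    Parks c = ParksAt (σ ⟨$⟩ˡ c) (lookup α c)

    parkCar-filled : ∀ {s} c → OnlyEarlier (toℕ c) s →
      Filled (suc (toℕ c)) (parkCar k α s c) ⇔ (Filled (toℕ c) s × Parks c)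
    -- The lemma for spots speaks of the car on the spot of `c`, which is `c` only by `inverseʳ`;
    -- the car is generalised to `d` for the transport.
    parkCar-filled {s} c = subst
      (λ d → OnlyEarlier (toℕ d) s →
         Filled (suc (toℕ d)) (parkCar k α s d) ⇔
           (Filled (toℕ d) s × ParksAt (σ ⟨$⟩ˡ c) (lookup α d)))
      (inverseʳ σ) (parkCar-filled-at {s = s} (σ ⟨$⟩ˡ c))

    -- Generalises `allFin n` to its tails: `f` lists the cars `m, …, n - 1`, so that the induction
    -- can peel off one arrival at a time.
    parkAll-filled : ∀ {p m s} (f : Fin p → Fin n) → (∀ x → toℕ (f x) ≡ m + toℕ x) →
      m + p ≡ n → OnlyEarlier m s →
      Filled n (foldl (parkCar k α) s (tabulate f)) ⇔ (Filled m s × ∀ x → Parks (f x))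
    parkAll-filled {zero} {m} {s} f f≡ m+0≡n _
      rewrite trans (sym (ℕ.+-identityʳ m)) m+0≡n = mk⇔ (λ filled → filled , λ ()) proj₁
    parkAll-filled {suc p} {m} {s} f f≡ m+1+p≡n early
      -- Identifies `m` with the index of the next car, so that the equivalence for one car applies.
      with refl ← trans (sym (ℕ.+-identityʳ m)) (sym (f≡ zero)) = mk⇔
        (λ filled →
           let later , parks  = to rest filled
               now   , parks₀ = to step later
           in now , λ { zero → parks₀ ; (suc x) → parks x })
        (λ (filled , parks) → from rest (from step (filled , parks zero) , parks ∘ suc))
      where
      step = parkCar-filled {s = s} (f zero) early
      rest = parkAll-filled {s = parkCar k α s (f zero)} (f ∘ suc)
               (λ x → trans (f≡ (suc x)) (ℕ.+-suc _ (toℕ x)))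
               (trans (sym (ℕ.+-suc _ p)) m+1+p≡n) (parkCar-onlyEarlier {s = s} (f zero) early)

    outcome-filled : Filled n (outcome k α) ⇔ (∀ c → Parks c)
    outcome-filled = mk⇔ (proj₂ ∘ to all) (λ parks → from all (empty , parks))
      where
      empty : Filled 0 (replicate n nothing)
      empty j = (λ ()) , (λ _ → lookup-replicate j nothing)

      all = parkAll-filled {s = replicate n nothing} (λ x → x) (λ _ → refl) refl
              (filled⇒onlyEarlier {s = replicate n nothing} empty)

    -- At `m = n` the first clause of `Filled` always applies and the second never does, so spot `j`
    -- holds car `σ j`. Car `c` is then parked on its spot under the inverse of `σ`, and the
    -- occupants determine `φ`.
    fiber-filled : Filled n (outcome k α) ⇔ φ⁻¹ k σ α
    fiber-filled = mk⇔
      (λ filled → let occupant j = proj₁ (filled j) (toℕ<n _)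
                      parked c = σ ⟨$⟩ˡ c , trans (occupant _) (cong just (inverseʳ σ)) in
         parked , λ i → just-injective (trans (sym (φ-occupant k (α , parked) i)) (occupant i)))
      (λ (parked , φ≈σ) j →
         (λ _ → trans (φ-occupant k (α , parked) j) (cong just (φ≈σ j))) ,
         (λ n≤σj → contradiction (toℕ<n _) (ℕ.≤⇒≯ n≤σj)))

-- Block lengths as thresholds, and how blocks describe the admissible preferences.

max-filter-upper : {P : Pred (Fin n) p} (P? : Decidable P) (f : Fin n → ℕ) → ∀ {x} → P x →
                   f x ≤ max 0 (map f (filter P? (allFin n)))
max-filter-upper P? f {x} px =
  All.lookup (xs≤max 0 _) (∈-map⁺ f (∈-filter⁺ P? (∈-allFin x) px))

-- The case `m ≡ 0` is the default value of `max`; carrying it along avoids a proof that the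
-- filtered list is nonempty.
max-filter-attained : {P : Pred (Fin n) p} (P? : Decidable P) (f : Fin n → ℕ) →
  let m = max 0 (map f (filter P? (allFin n))) in m ≡ 0 ⊎ (∃ λ x → P x × m ≡ f x)
max-filter-attained {n} P? f with argmax-sel (λ x → x) 0 (map f (filter P? (allFin n)))
... | inj₁ m≡0 = inj₁ m≡0
... | inj₂ m∈ with x , x∈ , m≡fx ← ∈-map⁻ f m∈ =
  inj₂ (x , proj₂ (∈-filter⁻ P? {xs = allFin n} x∈) , m≡fx)

m∸n≤o⇔m≤n+o : ∀ m n o → m ∸ n ≤ o ⇔ m ≤ n + o
m∸n≤o⇔m≤n+o m n o = mk⇔
  (λ m∸n≤o → ℕ.≤-trans (ℕ.m≤n+m∸n m n) (ℕ.+-monoʳ-≤ n m∸n≤o)) (ℕ.m≤n+o⇒m∸n≤o m n)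

module _ (σ : Permutation′ n) (i : Fin n) where

  left≤ : left σ i ≤ toℕ i
  left≤ with max-filter-attained (leftBlock? σ i) (λ j → toℕ i ∸ toℕ j)
  ... | inj₁ eq rewrite eq         = z≤n
  ... | inj₂ (j , _ , eq) rewrite eq = ℕ.m∸n≤m (toℕ i) (toℕ j)

  -- A block stays a block when shortened from its left end, so the valid starts are exactly those
  -- within the maximal length of `i`.
  leftBlock-⇔ : ∀ {j} → j Fin.≤ i → LeftBlock σ i j ⇔ toℕ i ≤ toℕ j + left σ i
  leftBlock-⇔ {j} j≤i = mk⇔
    (λ block → to (m∸n≤o⇔m≤n+o (toℕ i) (toℕ j) _)
                  (max-filter-upper (leftBlock? σ i) (λ j → toℕ i ∸ toℕ j) block))
    bwd
    where
    bwd : toℕ i ≤ toℕ j + left σ i → LeftBlock σ i j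
    bwd i≤j+left with max-filter-attained (leftBlock? σ i) (λ j → toℕ i ∸ toℕ j)
    -- A maximum of zero forces `i ≤ j`, so the block is empty.
    ... | inj₁ eq rewrite eq | ℕ.+-identityʳ (toℕ j) =
      j≤i , λ t j≤t t<i → contradiction (ℕ.<-≤-trans t<i i≤j+left) (ℕ.≤⇒≯ j≤t)
    ... | inj₂ (j₀ , (j₀≤i , block) , eq) rewrite eq =
      j≤i , λ t j≤t → block t (ℕ.≤-trans j₀≤j j≤t)
      where
      j₀≤j : j₀ Fin.≤ j
      j₀≤j = ℕ.+-cancelʳ-≤ (toℕ i ∸ toℕ j₀) _ _
        (subst (_≤ toℕ j + (toℕ i ∸ toℕ j₀)) (sym (ℕ.m+[n∸m]≡n j₀≤i)) i≤j+left)

module _ (k : ℕ) (σ : Permutation′ n) (i : Fin n) where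

  private
    len : Fin n → ℕ
    len r = suc (toℕ r) ∸ toℕ i

    i+len : ∀ {r} → i Fin.≤ r → toℕ i + len r ≡ suc (toℕ r)
    i+len i≤r = ℕ.m+[n∸m]≡n (ℕ.m≤n⇒m≤1+n i≤r)

  i+right≤n : toℕ i + right k σ i ≤ n
  i+right≤n with max-filter-attained (rightBlock? k σ i) len
  ... | inj₁ eq rewrite eq | ℕ.+-identityʳ (toℕ i) = ℕ.<⇒≤ (toℕ<n i)
  ... | inj₂ (r , (i≤r , _) , eq) rewrite eq | i+len i≤r = toℕ<n r

  -- Shortening a block at its right end preserves both the bound on the entries and the bound
  -- `i + k`, so the valid ends form one stretch starting at `i`.
  rightBlock-⇔ : ∀ {r} → i Fin.≤ r → RightBlock k σ i r ⇔ toℕ r < toℕ i + right k σ i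
  rightBlock-⇔ {r} i≤r = mk⇔
    (λ block → to (m∸n≤o⇔m≤n+o (suc (toℕ r)) (toℕ i) _)
                  (max-filter-upper (rightBlock? k σ i) len block))
    bwd
    where
    bwd : toℕ r < toℕ i + right k σ i → RightBlock k σ i r
    bwd r<i+right with max-filter-attained (rightBlock? k σ i) len
    ... | inj₁ eq rewrite eq | ℕ.+-identityʳ (toℕ i) = contradiction r<i+right (ℕ.≤⇒≯ i≤r)
    ... | inj₂ (r₀ , (i≤r₀ , r₀≤i+k , block) , eq) rewrite eq | i+len i≤r₀ =
      i≤r , ℕ.≤-trans r≤r₀ r₀≤i+k , λ t i≤t t≤r → block t i≤t (ℕ.≤-trans t≤r r≤r₀)
      where
      r≤r₀ : r Fin.≤ r₀
      r≤r₀ = s≤s⁻¹ r<i+right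

  -- To reach `i` the car backs over `a, a - 1, …, i + 1`, all within the limit once `a ≤ i + k`.
  -- Injectivity of `σ` makes the weak inequalities of the block strict on these spots, and `t = i`
  -- is its one case of equality.
  parksAt-behind : ∀ {a} → i Fin.≤ a → ParksAt k σ i a ⇔ RightBlock k σ i a
  parksAt-behind {a} i≤a = mk⇔
    (λ (a≤i+k , before) → i≤a , a≤i+k , λ t i≤t t≤a →
       bound t t≤a (ℕ.m≤n⇒m<n∨m≡n i≤t) (λ a≤t+k t≺i → before t a≤t+k t≺i) a≤i+k)
    (λ (_ , a≤i+k , block) → a≤i+k , λ
       { t a≤t+k (inj₁ (i<t , t≤a)) → ℕ.≤∧≢⇒< (block t (ℕ.<⇒≤ i<t) t≤a)
           (λ eq → ℕ.<-irrefl (cong toℕ (sym (⟨$⟩ʳ-injective σ (toℕ-injective eq)))) i<t)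
       ; t a≤t+k (inj₂ (a<i , _)) → contradiction i≤a (ℕ.<⇒≱ a<i) })
    where
    bound : ∀ t → t Fin.≤ a → toℕ i < toℕ t ⊎ toℕ i ≡ toℕ t →
            (toℕ a ≤ toℕ t + k → CheckedBefore a t i → σ ⟨$⟩ʳ t Fin.< σ ⟨$⟩ʳ i) →
            toℕ a ≤ toℕ i + k → σ ⟨$⟩ʳ t Fin.≤ σ ⟨$⟩ʳ i
    bound t t≤a (inj₁ i<t) before a≤i+k = ℕ.<⇒≤
      (before (ℕ.≤-trans a≤i+k (ℕ.+-monoˡ-≤ k (ℕ.<⇒≤ i<t))) (inj₁ (i<t , t≤a)))
    bound t t≤a (inj₂ i≡t) before a≤i+k =
      ℕ.≤-reflexive (cong (λ x → toℕ (σ ⟨$⟩ʳ x)) (sym (toℕ-injective i≡t)))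

  -- The car goes forward from a only if the k spots behind a, or all of them back
  -- to the first spot, are occupied; truncation in a ∸ k covers the second case.
  parksAt-ahead : ∀ {a} → a Fin.< i → ParksAt k σ i a ⇔ toℕ i ≤ (toℕ a ∸ k) + left σ i
  parksAt-ahead {a} a<i = subst (λ x → ParksAt k σ i a ⇔ toℕ i ≤ x + left σ i) (toℕ-fromℕ< a∸k<n)
    (leftBlock-⇔ σ i j≤i ⇔-∘ mk⇔
      (λ (_ , before) → j≤i , λ t j≤t t<i →
         before t (from-j j≤t) (inj₂ (a<i , t<i)))
      (λ (_ , block) → ℕ.≤-trans (ℕ.<⇒≤ a<i) (ℕ.m≤m+n _ k) , λ
         { t a≤t+k (inj₁ (i<t , t≤a)) → contradiction (ℕ.<-≤-trans i<t t≤a) (ℕ.<-asym a<i)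
         ; t a≤t+k (inj₂ (_ , t<i)) → block t (to-j a≤t+k) t<i }))
    where
    a∸k<n : toℕ a ∸ k < n
    a∸k<n = ℕ.≤-<-trans (ℕ.m∸n≤m (toℕ a) k) (toℕ<n a)

    -- The farthest spot reached in backing up from `a`. The spots checked before `i` are then
    -- exactly `j, …, i - 1`, a block to the left of `i`.
    j : Fin n
    j = fromℕ< a∸k<n

    j≤i : j Fin.≤ i
    j≤i = subst (_≤ toℕ i) (sym (toℕ-fromℕ< a∸k<n))
            (ℕ.≤-trans (ℕ.m∸n≤m (toℕ a) k) (ℕ.<⇒≤ a<i))

    from-j : ∀ {t} → j Fin.≤ t → toℕ a ≤ toℕ t + k
    from-j {t} j≤t = subst (toℕ a ≤_) (ℕ.+-comm k (toℕ t))
      (to (m∸n≤o⇔m≤n+o (toℕ a) k _) (subst (_≤ toℕ t) (toℕ-fromℕ< a∸k<n) j≤t))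

    to-j : ∀ {t} → toℕ a ≤ toℕ t + k → j Fin.≤ t
    to-j {t} a≤t+k = subst (_≤ toℕ t) (sym (toℕ-fromℕ< a∸k<n))
      (from (m∸n≤o⇔m≤n+o (toℕ a) k _) (subst (toℕ a ≤_) (ℕ.+-comm (toℕ t) k) a≤t+k))

-- Each inequality rules out truncation in its own difference: with `a < k` the left one would read
-- `i ≤ l`, with `l < k` the right one would read `i ≤ a`. So `k` can be moved across, trading a
-- shift of the preference for the shortening of the block in `ℓ`.
≤[∸]+⇔≤+[∸] : ∀ {a i l} k → a < i → l < i → i ≤ (a ∸ k) + l ⇔ i ≤ a + (l ∸ k)
≤[∸]+⇔≤+[∸] {a} {i} {l} k a<i l<i = mk⇔ fwd bwd
  where
  open ℕ.≤-Reasoning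

  regroup : ∀ x y → x + (k + y) ≡ (k + x) + y
  regroup x y = trans (sym (ℕ.+-assoc x k y)) (cong (_+ y) (ℕ.+-comm x k))

  fwd : i ≤ (a ∸ k) + l → i ≤ a + (l ∸ k)
  fwd i≤ = begin
    i                         ≤⟨ i≤ ⟩
    (a ∸ k) + l               ≤⟨ ℕ.+-monoʳ-≤ (a ∸ k) (ℕ.m≤n+m∸n l k) ⟩
    (a ∸ k) + (k + (l ∸ k))   ≡⟨ regroup (a ∸ k) (l ∸ k) ⟩
    (k + (a ∸ k)) + (l ∸ k)   ≡⟨ cong (_+ (l ∸ k)) (ℕ.m+[n∸m]≡n k≤a) ⟩
    a + (l ∸ k)               ∎
    where
    k≤a : k ≤ a
    k≤a = ℕ.≮⇒≥ λ a<k → ℕ.<⇒≱ l<i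
      (subst (λ x → i ≤ x + l) (ℕ.m≤n⇒m∸n≡0 (ℕ.<⇒≤ a<k)) i≤)

  bwd : i ≤ a + (l ∸ k) → i ≤ (a ∸ k) + l
  bwd i≤ = begin
    i                         ≤⟨ i≤ ⟩
    a + (l ∸ k)               ≤⟨ ℕ.+-monoˡ-≤ (l ∸ k) (ℕ.m≤n+m∸n a k) ⟩
    (k + (a ∸ k)) + (l ∸ k)   ≡⟨ regroup (a ∸ k) (l ∸ k) ⟨
    (a ∸ k) + (k + (l ∸ k))   ≡⟨ cong ((a ∸ k) +_) (ℕ.m+[n∸m]≡n k≤l) ⟩
    (a ∸ k) + l               ∎
    where
    k≤l : k ≤ l
    k≤l = ℕ.≮⇒≥ λ l<k → ℕ.<⇒≱ a<i
      (subst (i ≤_) (trans (cong (a +_) (ℕ.m≤n⇒m∸n≡0 (ℕ.<⇒≤ l<k))) (ℕ.+-identityʳ a)) i≤)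

-- The number of admissible preferences of one car.

module _ (k : ℕ) (σ : Permutation′ n) (i : Fin n) where

  private
    ℓ-if : Bool → ℕ
    ℓ-if full = if full then left σ i + right k σ i else (left σ i ∸ k) + right k σ i

  -- Here `e` counts the admissible spots before `i` in both cases of `ℓ`. If the left block reaches
  -- the first spot, both inequalities hold for every `a`; otherwise `left σ i < i` and the shift by
  -- `k` moves from `a` to the block length.
  ℓ-split : ∃ λ e → e ≤ toℕ i × ℓ k σ i ≡ e + right k σ i ×
            (∀ {a} → a < toℕ i → toℕ i ≤ (a ∸ k) + left σ i ⇔ toℕ i ≤ a + e)
  ℓ-split with left σ i ℕ.≟ toℕ i
  ... | yes left≡i = left σ i , left≤ σ i ,
    cong ℓ-if (dec-true (left σ i ℕ.≟ toℕ i) left≡i) ,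
    λ _ → mk⇔ (λ _ → i≤+left _) (λ _ → i≤+left _)
    where
    i≤+left : ∀ x → toℕ i ≤ x + left σ i
    i≤+left x = subst (λ l → l ≤ x + left σ i) left≡i (ℕ.m≤n+m _ x)
  ... | no left≢i = left σ i ∸ k , ℕ.≤-trans (ℕ.m∸n≤m _ k) (left≤ σ i) ,
    cong ℓ-if (dec-false (left σ i ℕ.≟ toℕ i) left≢i) ,
    λ a<i → ≤[∸]+⇔≤+[∸] k a<i (ℕ.≤∧≢⇒< (left≤ σ i) left≢i)

  -- The admissible spots before `i` start at `i - e`, and those from `i` on stop just before
  -- `i + right k σ i`. The two pieces meet at `i` and form one interval.
  ∣ParksAt∣ : ∣ ParksAt k σ i ∣≡ ℓ k σ i
  ∣ParksAt∣ with e , e≤i , ℓ≡ , ahead⇔ ← ℓ-split = subst (∣ ParksAt k σ i ∣≡_) (sym ℓ≡)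
    (∣∣≡-resp-⇔ interval
      (∣interval∣ (toℕ i ∸ e) (e + right k σ i) (subst (_≤ n) (sym end) (i+right≤n k σ i))))
    where
    end : (toℕ i ∸ e) + (e + right k σ i) ≡ toℕ i + right k σ i
    end = trans (sym (ℕ.+-assoc (toℕ i ∸ e) e _)) (cong (_+ right k σ i) (ℕ.m∸n+n≡m e≤i))

    interval : ∀ a → (toℕ i ∸ e ≤ toℕ a × toℕ a < (toℕ i ∸ e) + (e + right k σ i)) ⇔ ParksAt k σ i a
    interval a rewrite end with toℕ a ℕ.<? toℕ i
    ... | yes a<i = ⇔-sym (parksAt-ahead k σ i a<i) ⇔-∘ (⇔-sym (ahead⇔ a<i) ⇔-∘ mk⇔
      (λ (lo≤a , _) → subst (toℕ i ≤_) (ℕ.+-comm e (toℕ a)) (to (m∸n≤o⇔m≤n+o (toℕ i) e _) lo≤a))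
      (λ i≤a+e → from (m∸n≤o⇔m≤n+o (toℕ i) e _) (subst (toℕ i ≤_) (ℕ.+-comm (toℕ a) e) i≤a+e)
               , ℕ.<-≤-trans a<i (ℕ.m≤m+n _ _)))
    ... | no a≮i = ⇔-sym (parksAt-behind k σ i i≤a) ⇔-∘ (⇔-sym (rightBlock-⇔ k σ i i≤a) ⇔-∘ mk⇔ proj₂
      (λ a<hi → ℕ.≤-trans (ℕ.m∸n≤m (toℕ i) e) i≤a , a<hi))
      where
      i≤a : i Fin.≤ a
      i≤a = ℕ.≮⇒≥ a≮i

theorem3p12 : (n k : ℕ) → 1 ≤ n → k ≤ n ∸ 1 → (σ : Permutation′ n) →
    ∣ φ⁻¹ k σ ∣≡ product (map (ℓ k σ) (allFin n))
theorem3p12 n k _ _ σ = subst (∣ φ⁻¹ k σ ∣≡_) reindex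
  (∣∣≡-resp-⇔ (λ α → fiber-filled k σ α ⇔-∘ ⇔-sym (outcome-filled k σ α))
    (∣Π∣ (ℓ k σ ∘ (σ ⟨$⟩ˡ_)) (λ c → ∣ParksAt∣ k σ (σ ⟨$⟩ˡ c))))
  where
  -- The coordinates of a preference are cars, so the product arises indexed by cars, each
  -- contributing the factor of its spot.
  reindex : product (map (ℓ k σ ∘ (σ ⟨$⟩ˡ_)) (allFin n)) ≡ product (map (ℓ k σ) (allFin n))
  reindex = trans (cong product (map-∘ (allFin n)))
                  (product-↭ (↭.map⁺ (ℓ k σ) (map-⟨$⟩ˡ-↭ σ)))
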